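{- Let $G$ be a game. Then $G \geqslant^-_{\mathcal{D}} 0$ if and only if $G \geqslant^-_{\mathcal{DB}} 0$.
   Context: A game is a finite two-player combinatorial game, defined recursively by $G=\{G^{\mathbf L}\mid G^{\mathbf R}\}$, where $G^{\mathbf L}$ and $G^{\mathbf R}$ are the finite sets of Left options and Right options, which are themselves games. The game $0=\{\cdot\mid\cdot\}$ has no options. The sum is $G+H=\{G^{\mathbf L}+H,\,G+H^{\mathbf L}\mid G^{\mathbf R}+H,\,G+H^{\mathbf R}\}$. Left and Right alternate moves. Under misère play, a player who cannot move on their turn wins. The misère outcome $o^-(G)$ is $\mathcal L$ (Left wins whoever starts), $\mathcal R$ (Right wins whoever starts), $\mathcal N$ (the first player wins) or $\mathcal P$ (the second player wins). Outcomes are partially ordered by $\mathcal R<\mathcal N<\mathcal L$ and $\mathcal R<\mathcal P<\mathcal L$, with $\mathcal N$ and $\mathcal P$ incomparable. For a set $\mathcal U$ of games and games $G,H$ (not necessarily in $\mathcal U$), $G\geqslant^-_{\mathcal U}H$ means $o^-(G+X)\geqslant o^-(H+X)$ for every $X\in\mathcal U$. A game is dicot if it is $0$, or if it has both Left and Right options and all of them are dicot. A game is binary if it has at most one Left option and at most one Right option, and all these options, if any, are binary. $\mathcal D$ is the set of all dicot games and $\mathcal{DB}$ is the set of all games that are both binary and dicot. -}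

module Defs where

open import Data.Bool.Base using (Bool; true; false; not; _∨_)
open import Data.List.Base using (List; []; _∷_; _++_; length)
open import Data.List.Relation.Unary.All using (All)
open import Data.Nat.Base using (_≤_)
open import Level using (0ℓ)
open import Relation.Binary.PropositionalEquality using (_≢_)
open import Relation.Unary using (Pred; _∩_)

-- The finite sets of Left and Right options are represented by lists.  Order
-- and repetition of options affect neither sums (as sets) nor outcomes.
data Game : Set where
  ⟨_∣_⟩ : (Gᴸ Gᴿ : List Game) → Game

𝟘 : Game
𝟘 = ⟨ [] ∣ [] ⟩

infixl 6 _+_

-- Gs +ˡ H and G +ʳ Hs are map (_+ H) Gs and map (G +_) Hs, written out
-- so that the recursion is visibly structural.
mutual
  _+_ : Game → Game → Game
  G@(⟨ Gᴸ ∣ Gᴿ ⟩) + H@(⟨ Hᴸ ∣ Hᴿ ⟩) =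
    ⟨ (Gᴸ +ˡ H) ++ (G +ʳ Hᴸ) ∣ (Gᴿ +ˡ H) ++ (G +ʳ Hᴿ) ⟩

  _+ˡ_ : List Game → Game → List Game
  []       +ˡ H = []
  (G ∷ Gs) +ˡ H = (G + H) ∷ (Gs +ˡ H)

  _+ʳ_ : Game → List Game → List Game
  G +ʳ []       = []
  G +ʳ (H ∷ Hs) = (G + H) ∷ (G +ʳ Hs)

data Player : Set where
  left right : Player

-- winsFirst p G: under misère play, p wins G when p is the one to move.  This
-- holds if p has no move, or has a move to a game that the opponent, now to
-- move, does not win.  someLost q Gs: q, to move, loses some member of Gs.
mutual
  winsFirst : Player → Game → Bool
  winsFirst left  ⟨ [] ∣ _ ⟩            = true
  winsFirst left  ⟨ Gᴸ@(_ ∷ _) ∣ _ ⟩    = someLost right Gᴸ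
  winsFirst right ⟨ _ ∣ [] ⟩            = true
  winsFirst right ⟨ _ ∣ Gᴿ@(_ ∷ _) ⟩    = someLost left Gᴿ

  someLost : Player → List Game → Bool
  someLost q []       = false
  someLost q (G ∷ Gs) = not (winsFirst q G) ∨ someLost q Gs

data Outcome : Set where
  𝓛 𝓡 𝓝 𝓟 : Outcome

-- First argument: Left wins moving first.  Second: Right wins moving first.
-- Play is finite without draws, so exactly one player wins for each starter.
toOutcome : Bool → Bool → Outcome
toOutcome true  false = 𝓛
toOutcome false true  = 𝓡
toOutcome true  true  = 𝓝
toOutcome false false = 𝓟

o⁻ : Game → Outcome
o⁻ G = toOutcome (winsFirst left G) (winsFirst right G)

infix 4 _≤ᵒ_ _≥ᵒ_

data _≤ᵒ_ : Outcome → Outcome → Set where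
  reflᵒ : ∀ {a} → a ≤ᵒ a
  𝓡≤𝓝   : 𝓡 ≤ᵒ 𝓝
  𝓡≤𝓟   : 𝓡 ≤ᵒ 𝓟
  𝓡≤𝓛   : 𝓡 ≤ᵒ 𝓛
  𝓝≤𝓛   : 𝓝 ≤ᵒ 𝓛
  𝓟≤𝓛   : 𝓟 ≤ᵒ 𝓛

_≥ᵒ_ : Outcome → Outcome → Set
a ≥ᵒ b = b ≤ᵒ a

infix 4 _≥⁻[_]_

_≥⁻[_]_ : Game → Pred Game 0ℓ → Game → Set
G ≥⁻[ 𝓤 ] H = ∀ X → 𝓤 X → o⁻ (G + X) ≥ᵒ o⁻ (H + X)

data Dicot : Pred Game 0ℓ where
  dicot-𝟘 : Dicot 𝟘
  dicot   : ∀ {Gᴸ Gᴿ} → Gᴸ ≢ [] → Gᴿ ≢ [] →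
            All Dicot Gᴸ → All Dicot Gᴿ → Dicot ⟨ Gᴸ ∣ Gᴿ ⟩

-- A list repeating one option is not counted as binary; the set it represents
-- is also represented by the list without repetition, which is.
data Binary : Pred Game 0ℓ where
  binary : ∀ {Gᴸ Gᴿ} → length Gᴸ ≤ 1 → length Gᴿ ≤ 1 →
           All Binary Gᴸ → All Binary Gᴿ → Binary ⟨ Gᴸ ∣ Gᴿ ⟩

𝓓 : Pred Game 0ℓ
𝓓 = Dicot

𝓓𝓑 : Pred Game 0ℓ
𝓓𝓑 = Binary ∩ Dicot

-- Call G good if Left wins G moving first and every Gᴿ has a good Gᴿᴸ.  If G is
-- good then G ≥⁻[ 𝓓 ] 𝟘: Left follows her strategy on the dicot X and answers
-- each Right move in G by a move to a good game.
--
-- For the converse, tested on binary dicots only, suppose C is such that Right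
-- wins H + C moving first, for all subpositions H of G, and put
-- Z = ⟨ C ∣ 𝟘 ⟩.  Left wins Z moving second.  If G is not good, Right wins G + Z
-- moving first: he moves Z to 𝟘 if Left loses G moving first, and otherwise he
-- moves to a Gᴿ none of whose Left options is good, so that Left either moves to
-- some Gᴿᴸ + Z, which is again lost by induction, or to Gᴿ + C.  Thus a single
-- test Z decides goodness, and a binary Z exists because C can be taken binary.
module Submission where

open import Data.Bool.Base using (true; false; _∨_)
open import Data.Bool.Properties using (¬-not)
open import Data.Empty using (⊥-elim)
open import Data.List.Base using (List; []; _∷_; _++_; map; null)
open import Data.List.Membership.Propositional using (_∈_)
open import Data.List.Membership.Propositional.Properties
  using (∈-map⁺; ∈-map⁻; ∈-++⁺ˡ; ∈-++⁺ʳ; ∈-++⁻)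
open import Data.List.Properties using (++-identityʳ)
open import Data.List.Relation.Unary.All using ([]; _∷_; lookup)
open import Data.List.Relation.Unary.Any using (here; there)
open import Data.Nat.Base using (ℕ; zero; suc; _≤_; _⊔_; z≤n; s≤s)
open import Data.Nat.Properties using (≤-refl; m≤n⇒m≤1+n; <⇒≤; m≤m⊔n; m≤n⊔m)
open import Data.Product using (∃; _×_; _,_)
open import Data.Sum using (_⊎_; inj₁; inj₂)
open import Defs
open import Function.Base using (case_of_)
open import Function.Bundles using (_⇔_; mk⇔)
open import Relation.Binary.PropositionalEquality

-- Players and their options

opponent : Player → Player
opponent left  = right
opponent right = left

options : Player → Game → List Game
options left  ⟨ Gᴸ ∣ _ ⟩ = Gᴸ
options right ⟨ _ ∣ Gᴿ ⟩ = Gᴿ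

∈⇒≢[] : ∀ {K : Game} {Gs} → K ∈ Gs → Gs ≢ []
∈⇒≢[] (here _)  ()
∈⇒≢[] (there _) ()

noOption⊎option : ∀ p G → options p G ≡ [] ⊎ (∃ λ K → K ∈ options p G)
noOption⊎option p G with options p G
... | []    = inj₁ refl
... | K ∷ _ = inj₂ (K , here refl)

-- Options of sums

+ˡ≡map : ∀ Gs H → Gs +ˡ H ≡ map (_+ H) Gs
+ˡ≡map []       H = refl
+ˡ≡map (G ∷ Gs) H = cong (G + H ∷_) (+ˡ≡map Gs H)

+ʳ≡map : ∀ G Hs → G +ʳ Hs ≡ map (G +_) Hs
+ʳ≡map G []       = refl
+ʳ≡map G (H ∷ Hs) = cong (G + H ∷_) (+ʳ≡map G Hs)

options-+ : ∀ p G H →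
            options p (G + H) ≡ map (_+ H) (options p G) ++ map (G +_) (options p H)
options-+ left  G@(⟨ Gᴸ ∣ _ ⟩) H@(⟨ Hᴸ ∣ _ ⟩) = cong₂ _++_ (+ˡ≡map Gᴸ H) (+ʳ≡map G Hᴸ)
options-+ right G@(⟨ _ ∣ Gᴿ ⟩) H@(⟨ _ ∣ Hᴿ ⟩) = cong₂ _++_ (+ˡ≡map Gᴿ H) (+ʳ≡map G Hᴿ)

∈-+⁺ˡ : ∀ p G H {K} → K ∈ options p G → K + H ∈ options p (G + H)
∈-+⁺ˡ p G H K∈ = subst (_ ∈_) (sym (options-+ p G H)) (∈-++⁺ˡ (∈-map⁺ (_+ H) K∈))

∈-+⁺ʳ : ∀ p G H {K} → K ∈ options p H → G + K ∈ options p (G + H)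
∈-+⁺ʳ p G H K∈ = subst (_ ∈_) (sym (options-+ p G H)) (∈-++⁺ʳ _ (∈-map⁺ (G +_) K∈))

∈-+⁻ : ∀ p G H {K} → K ∈ options p (G + H) →
       (∃ λ G′ → G′ ∈ options p G × K ≡ G′ + H) ⊎ (∃ λ H′ → H′ ∈ options p H × K ≡ G + H′)
∈-+⁻ p G H K∈ with ∈-++⁻ (map (_+ H) (options p G)) (subst (_ ∈_) (options-+ p G H) K∈)
... | inj₁ K∈ˡ = inj₁ (∈-map⁻ (_+ H) K∈ˡ)
... | inj₂ K∈ʳ = inj₂ (∈-map⁻ (G +_) K∈ʳ)

mutual
  +-identityʳ : ∀ G → G + 𝟘 ≡ G
  +-identityʳ ⟨ Gᴸ ∣ Gᴿ ⟩ = cong₂ ⟨_∣_⟩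
    (trans (++-identityʳ _) (+ˡ-identityʳ Gᴸ)) (trans (++-identityʳ _) (+ˡ-identityʳ Gᴿ))

  +ˡ-identityʳ : ∀ Gs → Gs +ˡ 𝟘 ≡ Gs
  +ˡ-identityʳ []       = refl
  +ˡ-identityʳ (G ∷ Gs) = cong₂ _∷_ (+-identityʳ G) (+ˡ-identityʳ Gs)

mutual
  +-identityˡ : ∀ G → 𝟘 + G ≡ G
  +-identityˡ ⟨ Gᴸ ∣ Gᴿ ⟩ = cong₂ ⟨_∣_⟩ (+ʳ-identityˡ Gᴸ) (+ʳ-identityˡ Gᴿ)

  +ʳ-identityˡ : ∀ Gs → 𝟘 +ʳ Gs ≡ Gs
  +ʳ-identityˡ []       = refl
  +ʳ-identityˡ (G ∷ Gs) = cong₂ _∷_ (+-identityˡ G) (+ʳ-identityˡ Gs)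

-- Winning and losing

-- One equation for both players, so that later arguments take the player as a parameter; the `null`
-- disjunct is the misère convention.
winsFirst-options : ∀ p G →
  winsFirst p G ≡ null (options p G) ∨ someLost (opponent p) (options p G)
winsFirst-options left  ⟨ [] ∣ _ ⟩    = refl
winsFirst-options left  ⟨ _ ∷ _ ∣ _ ⟩ = refl
winsFirst-options right ⟨ _ ∣ [] ⟩    = refl
winsFirst-options right ⟨ _ ∣ _ ∷ _ ⟩ = refl

someLost⁺ : ∀ q {K Gs} → K ∈ Gs → winsFirst q K ≡ false → someLost q Gs ≡ true
someLost⁺ q (here refl) eq rewrite eq = refl
someLost⁺ q {Gs = G ∷ _} (there K∈) eq with winsFirst q G
... | false = refl
... | true  = someLost⁺ q K∈ eq

someLost⁻ : ∀ q Gs → someLost q Gs ≡ true → ∃ λ K → K ∈ Gs × winsFirst q K ≡ false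
someLost⁻ q (G ∷ Gs) lost with winsFirst q G in eq
... | false = G , here refl , eq
... | true  = let K , K∈ , K-lost = someLost⁻ q Gs lost in K , there K∈ , K-lost

winsFirst-end : ∀ p G → options p G ≡ [] → winsFirst p G ≡ true
winsFirst-end p G eq rewrite winsFirst-options p G | eq = refl

winsFirst-move : ∀ p G {K} → K ∈ options p G → winsFirst (opponent p) K ≡ false →
                 winsFirst p G ≡ true
winsFirst-move p G K∈ K-lost
  rewrite winsFirst-options p G | someLost⁺ (opponent p) K∈ K-lost with null (options p G)
... | true  = refl
... | false = refl

winsFirst⁻ : ∀ p G → winsFirst p G ≡ true →
  options p G ≡ [] ⊎ (∃ λ K → K ∈ options p G × winsFirst (opponent p) K ≡ false)
winsFirst⁻ p G won rewrite winsFirst-options p G with options p G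
... | []     = inj₁ refl
... | K ∷ Ks = inj₂ (someLost⁻ (opponent p) (K ∷ Ks) won)

true≢false : true ≢ false
true≢false ()

-- The given option rules out that the player is stuck, and so wins.
losesFirst : ∀ p G {K} → K ∈ options p G →
             (∀ {K} → K ∈ options p G → winsFirst (opponent p) K ≡ true) →
             winsFirst p G ≡ false
losesFirst p G K∈ all-won = ¬-not λ won → case winsFirst⁻ p G won of λ where
  (inj₁ none)            → ∈⇒≢[] K∈ none
  (inj₂ (K , K∈ , lost)) → true≢false (trans (sym (all-won K∈)) lost)

losesFirst-move⁻ : ∀ p G {K} → winsFirst p G ≡ false → K ∈ options p G →
                   winsFirst (opponent p) K ≡ true
losesFirst-move⁻ p G lost K∈ = ¬-not λ K-lost →
  true≢false (trans (sym (winsFirst-move p G K∈ K-lost)) lost)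

losesFirst-nonempty : ∀ p G → winsFirst p G ≡ false → ∃ λ K → K ∈ options p G
losesFirst-nonempty p G lost with noOption⊎option p G
... | inj₁ none = ⊥-elim (true≢false (trans (sym (winsFirst-end p G none)) lost))
... | inj₂ some = some

losesFirst-+ : ∀ p G H {K} → K ∈ options p H →
  (∀ {G′} → G′ ∈ options p G → winsFirst (opponent p) (G′ + H) ≡ true) →
  (∀ {H′} → H′ ∈ options p H → winsFirst (opponent p) (G + H′) ≡ true) →
  winsFirst p (G + H) ≡ false
losesFirst-+ p G H K∈ wonˡ wonʳ = losesFirst p (G + H) (∈-+⁺ʳ p G H K∈) λ L∈ →
  case ∈-+⁻ p G H L∈ of λ where
    (inj₁ (_ , G′∈ , refl)) → wonˡ G′∈
    (inj₂ (_ , H′∈ , refl)) → wonʳ H′∈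

losesFirst-+-sole : ∀ p G H {H′} → options p H ≡ H′ ∷ [] →
  (∀ {G′} → G′ ∈ options p G → winsFirst (opponent p) (G′ + H) ≡ true) →
  winsFirst (opponent p) (G + H′) ≡ true →
  winsFirst p (G + H) ≡ false
losesFirst-+-sole p G H {H′} sole wonˡ wonʳ =
  losesFirst-+ p G H (subst (H′ ∈_) (sym sole) (here refl)) wonˡ λ K∈ →
    case subst (_ ∈_) sole K∈ of λ { (here refl) → wonʳ }

winsFirst-+ˡ : ∀ p G H {G′} → G′ ∈ options p G →
               winsFirst (opponent p) (G′ + H) ≡ false → winsFirst p (G + H) ≡ true
winsFirst-+ˡ p G H G′∈ = winsFirst-move p (G + H) (∈-+⁺ˡ p G H G′∈)

winsFirst-+ʳ : ∀ p G H {H′} → H′ ∈ options p H →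
               winsFirst (opponent p) (G + H′) ≡ false → winsFirst p (G + H) ≡ true
winsFirst-+ʳ p G H H′∈ = winsFirst-move p (G + H) (∈-+⁺ʳ p G H H′∈)

-- The order on outcomes is the product of two comparisons, one for each starting player.
outcome-mono : ∀ G H → (winsFirst left H ≡ true → winsFirst left G ≡ true) →
               (winsFirst right H ≡ false → winsFirst right G ≡ false) → o⁻ G ≥ᵒ o⁻ H
outcome-mono G H f g
  with winsFirst left G | winsFirst right G | winsFirst left H | winsFirst right H
... | false | _     | true  | _     = case f refl of λ ()
... | _     | true  | _     | false = case g refl of λ ()
... | true  | false | true  | false = reflᵒ
... | true  | false | true  | true  = 𝓝≤𝓛
... | true  | false | false | false = 𝓟≤𝓛
... | true  | false | false | true  = 𝓡≤𝓛
... | true  | true  | true  | true  = reflᵒ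
... | true  | true  | false | true  = 𝓡≤𝓝
... | false | false | false | false = reflᵒ
... | false | false | false | true  = 𝓡≤𝓟
... | false | true  | false | true  = reflᵒ

≥ᵒ⇒losesFirst : ∀ G H → o⁻ G ≥ᵒ o⁻ H →
                winsFirst right H ≡ false → winsFirst right G ≡ false
≥ᵒ⇒losesFirst G H G≥H lost
  with winsFirst left G | winsFirst right G | winsFirst left H | winsFirst right H
... | _     | false | _     | _ = refl
≥ᵒ⇒losesFirst G H () refl | true  | true | true  | false
≥ᵒ⇒losesFirst G H () refl | true  | true | false | false
≥ᵒ⇒losesFirst G H () refl | false | true | true  | false
≥ᵒ⇒losesFirst G H () refl | false | true | false | false

-- Height of game trees, and options of dicots

-- Born n G: the game tree of G has height less than n.
data Born : ℕ → Game → Set where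
  born : ∀ {n G} → (∀ p {K} → K ∈ options p G → Born n K) → Born (suc n) G

born-mono : ∀ {m n G} → m ≤ n → Born m G → Born n G
born-mono (s≤s m≤n) (born b) = born λ p K∈ → born-mono m≤n (b p K∈)

mutual
  ∃-born : ∀ G → ∃ λ n → Born n G
  ∃-born ⟨ Gᴸ ∣ Gᴿ ⟩ =
    let l , bᴸ = ∃-born-all Gᴸ
        r , bᴿ = ∃-born-all Gᴿ
    in suc (l ⊔ r) , born λ where
      left  K∈ → born-mono (m≤m⊔n l r) (bᴸ K∈)
      right K∈ → born-mono (m≤n⊔m l r) (bᴿ K∈)

  ∃-born-all : ∀ Gs → ∃ λ n → ∀ {K} → K ∈ Gs → Born n K
  ∃-born-all []       = 0 , λ ()
  ∃-born-all (G ∷ Gs) =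
    let m , b  = ∃-born G
        n , bs = ∃-born-all Gs
    in m ⊔ n , λ where
      (here refl) → born-mono (m≤m⊔n m n) b
      (there K∈)  → born-mono (m≤n⊔m m n) (bs K∈)

dicot-option : ∀ p {X K} → Dicot X → K ∈ options p X → Dicot K
dicot-option left  (dicot _ _ dᴸ _) = lookup dᴸ
dicot-option right (dicot _ _ _ dᴿ) = lookup dᴿ
dicot-option left  dicot-𝟘 ()
dicot-option right dicot-𝟘 ()

dicot-end : ∀ {X} → Dicot X → options left X ≡ [] → X ≡ 𝟘
dicot-end dicot-𝟘          _  = refl
dicot-end (dicot ≢[] _ _ _) eq = ⊥-elim (≢[] eq)

-- Good games against dicots

data Good (G : Game) : Set where
  good : winsFirst left G ≡ true →
         (∀ {K} → K ∈ options right G → ∃ λ L → L ∈ options left K × Good L) →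
         Good G

mutual
  -- Each recursive call shrinks the derivation of `Good G` or that of `Born n X` and keeps the
  -- other.
  good-first : ∀ {n G X} → Good G → Born n X → Dicot X →
               winsFirst left X ≡ true → winsFirst left (G + X) ≡ true
  good-first {G = G} {X} g@(good G-won _) (born b) d won with winsFirst⁻ left X won
  ... | inj₂ (K , K∈ , lost) =
    winsFirst-+ʳ left G X K∈
      (good-second g (b left K∈) (dicot-option left d K∈) lost)
  -- Left is stuck in the dicot `X`, so `X` is `𝟘` and only `G` remains, which she wins moving
  -- first.
  ... | inj₁ none with dicot-end d none
  ... | refl = trans (cong (winsFirst left) (+-identityʳ G)) G-won

  good-second : ∀ {n G X} → Good G → Born n X → Dicot X →
                winsFirst right X ≡ false → winsFirst right (G + X) ≡ false
  good-second {G = G} {X} g@(good _ reply) bX@(born b) d lost =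
    -- Right loses `X` moving first, so he has a move there and cannot win `G + X` by being stuck.
    let _ , K∈ = losesFirst-nonempty right X lost in
    losesFirst-+ right G X K∈
      (λ {G′} G′∈ → let _ , L∈ , g′ = reply G′∈ in
                    winsFirst-+ˡ left G′ X L∈ (good-second g′ bX d lost))
      (λ X′∈ → good-first g (b right X′∈) (dicot-option right d X′∈)
                 (losesFirst-move⁻ right X lost X′∈))

good⇒≥𝟘 : ∀ {G} → Good G → G ≥⁻[ 𝓓 ] 𝟘
good⇒≥𝟘 {G} g X d rewrite +-identityˡ X =
  let _ , b = ∃-born X in outcome-mono (G + X) X
    (good-first g b d) (good-second g b d)

-- Binary dicots with which Right wins

-- Right wins H + rightFirst n moving first, and H + rightSecond n moving
-- second, whenever Born n H.
mutual
  rightFirst : ℕ → Game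
  -- No game satisfies `Born 0`, so the property is vacuous at `zero` and any binary dicot can stand
  -- here.
  rightFirst zero    = 𝟘
  rightFirst (suc n) = ⟨ rightFirst n ∷ [] ∣ ⟨ 𝟘 ∷ [] ∣ rightSecond n ∷ [] ⟩ ∷ [] ⟩

  rightSecond : ℕ → Game
  rightSecond zero    = 𝟘
  -- Left's move here leaves `H` as it is, so the index stays; Right moves here only after Left has
  -- lowered `H`, so it may drop.
  rightSecond (suc n) = ⟨ rightFirst (suc n) ∷ [] ∣ rightSecond n ∷ [] ⟩

-- While Right can move in H he does so, and Left must then answer in H or lower
-- n.  Once Right has no move in H he moves to ⟨ 𝟘 ∣ rightSecond n ⟩, where
-- Left's move to 𝟘 leaves him without a move, so that he wins.
mutual
  rightFirst-wins : ∀ {m n H} → m ≤ n → Born m H → winsFirst right (H + rightFirst n) ≡ true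
  rightFirst-wins {H = H} (s≤s {n = n} m≤n) (born b) with noOption⊎option right H
  ... | inj₁ none =
    winsFirst-+ʳ right H (rightFirst (suc n)) (here refl)
      (losesFirst-+-sole left H V refl
        -- Right may have moves again in `H′`, but its height is smaller, so `rightSecond n` is
        -- enough.
        (λ {H′} H′∈ → winsFirst-+ʳ right H′ V (here refl)
                        (rightSecond-wins m≤n (b left H′∈)))
        (winsFirst-end right (H + 𝟘) (trans (cong (options right) (+-identityʳ H)) none)))
    where
    V : Game
    V = ⟨ 𝟘 ∷ [] ∣ rightSecond n ∷ [] ⟩
  ... | inj₂ (K , K∈) =
    -- The drop in height from `H` to `K` makes up for Left lowering `suc n` to `n`.
    winsFirst-+ˡ right H (rightFirst (suc n)) K∈
      (losesFirst-+-sole left K (rightFirst (suc n)) refl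
        (rightFirst-wins-option m≤n (b right K∈))
        (rightFirst-wins m≤n (b right K∈)))

  rightFirst-wins-option : ∀ {m n K K′} → m ≤ n → Born m K → K′ ∈ options left K →
                           winsFirst right (K′ + rightFirst (suc n)) ≡ true
  rightFirst-wins-option (s≤s m≤n) (born b) K′∈ =
    rightFirst-wins (m≤n⇒m≤1+n (m≤n⇒m≤1+n m≤n)) (b left K′∈)

  rightSecond-wins : ∀ {m n H} → m ≤ n → Born m H → winsFirst left (H + rightSecond n) ≡ false
  rightSecond-wins {H = H} (s≤s {n = n} m≤n) bH@(born b) =
    losesFirst-+-sole left H (rightSecond (suc n)) refl
      (λ {H′} H′∈ → winsFirst-+ʳ right H′ (rightSecond (suc n)) (here refl)
                      (rightSecond-wins m≤n (b left H′∈)))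
      (rightFirst-wins (s≤s m≤n) bH)

-- The test for goodness

goodTest : ℕ → Game
goodTest n = ⟨ rightFirst n ∷ [] ∣ 𝟘 ∷ [] ⟩

-- The good reply to `K` is read off from a winning move of Left in `K + goodTest n`. Only `m` falls
-- in the recursion, so one test serves all subpositions.
goodTest-sound : ∀ {m n G} → m ≤ n → Born m G →
                 winsFirst right (G + goodTest n) ≡ false → Good G
goodTest-sound {suc m} {n} {G} m<n (born b) lost = good
  (trans (sym (cong (winsFirst left) (+-identityʳ G)))
    (losesFirst-move⁻ right (G + goodTest n) lost (∈-+⁺ʳ right G (goodTest n) (here refl))))
  reply
  where
  reply : ∀ {K} → K ∈ options right G → ∃ λ L → L ∈ options left K × Good L
  reply {K} K∈ with b right K∈ | winsFirst⁻ left (K + goodTest n)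
                      (losesFirst-move⁻ right (G + goodTest n) lost
                        (∈-+⁺ˡ right G (goodTest n) K∈))
  ... | _       | inj₁ none = ⊥-elim (∈⇒≢[] (∈-+⁺ʳ left K (goodTest n) (here refl)) none)
  ... | born b′ | inj₂ (_ , L∈ , L-lost) with ∈-+⁻ left K (goodTest n) L∈
  ... | inj₁ (L , L∈K , refl) =
    L , L∈K , goodTest-sound (<⇒≤ (<⇒≤ m<n)) (b′ left L∈K) L-lost
  -- The winning move is not in the test, since Right wins `K + rightFirst n` moving first.
  ... | inj₂ (_ , here refl , refl) =
    ⊥-elim (true≢false (trans (sym (rightFirst-wins (<⇒≤ m<n) (b right K∈))) L-lost))

𝓓𝓑-𝟘 : 𝓓𝓑 𝟘
𝓓𝓑-𝟘 = binary z≤n z≤n [] [] , dicot-𝟘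

𝓓𝓑-⟨∣⟩ : ∀ {G H} → 𝓓𝓑 G → 𝓓𝓑 H → 𝓓𝓑 ⟨ G ∷ [] ∣ H ∷ [] ⟩
𝓓𝓑-⟨∣⟩ (bG , dG) (bH , dH) =
  binary ≤-refl ≤-refl (bG ∷ []) (bH ∷ []) , dicot (λ ()) (λ ()) (dG ∷ []) (dH ∷ [])

mutual
  𝓓𝓑-rightFirst : ∀ n → 𝓓𝓑 (rightFirst n)
  𝓓𝓑-rightFirst zero    = 𝓓𝓑-𝟘
  𝓓𝓑-rightFirst (suc n) = 𝓓𝓑-⟨∣⟩ (𝓓𝓑-rightFirst n) (𝓓𝓑-⟨∣⟩ 𝓓𝓑-𝟘 (𝓓𝓑-rightSecond n))

  𝓓𝓑-rightSecond : ∀ n → 𝓓𝓑 (rightSecond n)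
  𝓓𝓑-rightSecond zero    = 𝓓𝓑-𝟘
  𝓓𝓑-rightSecond (suc n) = 𝓓𝓑-⟨∣⟩ (𝓓𝓑-rightFirst (suc n)) (𝓓𝓑-rightSecond n)

≥𝟘⇒good : ∀ {G} → G ≥⁻[ 𝓓𝓑 ] 𝟘 → Good G
≥𝟘⇒good {G} G≥𝟘 =
  let n , b = ∃-born G
      Z     = goodTest n
      G+Z≥Z = subst (λ X → o⁻ (G + Z) ≥ᵒ o⁻ X) (+-identityˡ Z)
                (G≥𝟘 Z (𝓓𝓑-⟨∣⟩ (𝓓𝓑-rightFirst n) 𝓓𝓑-𝟘))
  -- By computation Right loses `Z` moving first: his sole move is to `𝟘`, where Left is stuck and
  -- wins.
  in goodTest-sound ≤-refl b (≥ᵒ⇒losesFirst (G + Z) Z G+Z≥Z refl)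

theorem3p9 : (G : Game) → (G ≥⁻[ 𝓓 ] 𝟘) ⇔ (G ≥⁻[ 𝓓𝓑 ] 𝟘)
theorem3p9 G = mk⇔ (λ G≥𝟘 X (_ , d) → G≥𝟘 X d) (λ G≥𝟘 → good⇒≥𝟘 {G} (≥𝟘⇒good G≥𝟘))
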